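{- For every $\epsilon\geq 0$ there is an integer $n_0$ such that $f(n,3)\geq (0.34917-\epsilon)n$ for every integer $n\geq n_0$.
   Context: All graphs are finite, simple and undirected. For a bipartite graph $G$ with (fixed) partite sets $A$ and $B$, a bihole of order $k$ is an independent set $I$ of $G$ with $|I\cap A|=|I\cap B|=k$. For positive integers $n$ and $\Delta$, $f(n,\Delta)$ is the largest integer $k$ such that every bipartite graph $G$ with partite sets $A$ and $B$ such that $|A|=|B|=n$ and every vertex of $A$ has degree at most $\Delta$ in $G$ has a bihole of order $k$. -}

module Defs where

open import Data.Nat using (ℕ; _≤_)
open import Data.Fin using (Fin)
open import Data.Fin.Subset using (Subset; _∈_; ∣_∣)
open import Data.Product using (Σ; _×_)
open import Relation.Binary.PropositionalEquality using (_≡_)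
open import Relation.Nullary using (¬_)

-- A bipartite graph with partite sets A = Fin n and B = Fin n,
-- given by the neighbourhood (a subset of B) of each vertex of A.
-- (Finite, simple, undirected; all edges go between A and B.)
BipGraph : ℕ → Set
BipGraph n = Fin n → Subset n

Adj : ∀ {n} → BipGraph n → Fin n → Fin n → Set
Adj G a b = b ∈ G a

MaxDegA≤ : ∀ {n} → BipGraph n → ℕ → Set
MaxDegA≤ {n} G Δ = (a : Fin n) → ∣ G a ∣ ≤ Δ

-- a bihole of order k: an independent set I with |I ∩ A| = |I ∩ B| = k,
-- given by S = I ∩ A and T = I ∩ B (there are no edges inside A or inside B,
-- so independence means no edge between S and T).
IsBihole : ∀ {n} → BipGraph n → Subset n → Subset n → ℕ → Set
IsBihole {n} G S T k =
  ∣ S ∣ ≡ k × ∣ T ∣ ≡ k × ((a b : Fin n) → a ∈ S → b ∈ T → ¬ Adj G a b)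

HasBihole : ∀ {n} → BipGraph n → ℕ → Set
HasBihole {n} G k = Σ (Subset n) λ S → Σ (Subset n) λ T → IsBihole G S T k

AllHaveBihole : ℕ → ℕ → ℕ → Set
AllHaveBihole n Δ k = (G : BipGraph n) → MaxDegA≤ G Δ → HasBihole G k

IsF : ℕ → ℕ → ℕ → Set
IsF n Δ k = AllHaveBihole n Δ k × ((k' : ℕ) → AllHaveBihole n Δ k' → k' ≤ k)

{-# OPTIONS --safe #-}
module Submission where

-- Grow T ⊆ B one vertex at a time, discarding from S ⊆ A the neighbours of the
-- new vertex.  By averaging, some vertex outside T has at most ⌊3|S| / (n − |T|)⌋
-- neighbours in S.  Initially the average is 3, but it drops below 3 after one
-- step, so from then on each step costs only 2 vertices of S; when |T| reaches
-- n/4 and |S| is n/2 the average drops below 2, and each step costs only 1.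
-- The two sizes meet at 3n/8, up to an additive constant, and 3/8 > 0.34917.

open import Defs
open import Data.Bool using (Bool; true; false; _∧_)
open import Data.Fin using (Fin; zero; suc)
open import Data.Fin.Properties using (all?; any?)
open import Data.Fin.Subset using (Subset; inside; outside; _∈_; _∉_; _⊆_; _∩_; _∪_; _─_; ∣_∣; ⊤; ⊥; ⁅_⁆)
open import Data.Fin.Subset.Properties using (_∈?_; anySubset?; ∣p∣≤n; ∣⊤∣≡n; ∣⊥∣≡0; ∉⊥; x∈p∪q⁻; x∈⁅y⁆⇒x≡y; out⊆; s⊆s; ⊆-refl; ∪-identityʳ)
open import Data.Integer using (+_)
open import Data.Nat using (ℕ; zero; suc; z≤n; s≤s)
open import Data.Nat.DivMod using (_%_; m%n<n; m≡m%n+[m/n]*n)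
open import Data.Nat.Tactic.RingSolver using (solve-∀)
open import Data.Product using (Σ; ∃; _×_; _,_; proj₂)
open import Data.Rational using (ℚ; _/_; _-_; _*_; _≤_; 0ℚ; toℚᵘ)
open import Data.Sum using (inj₁; inj₂)
open import Data.Vec using (Vec; []; _∷_; lookup; tabulate; here; there)
open import Data.Vec.Properties using (lookup∘tabulate; lookup-zipWith; lookup⇒[]=; []=⇒lookup)
open import Function using (_∘_)
open import Relation.Binary.PropositionalEquality using (_≡_; _≗_; refl; sym; trans; cong; subst; subst₂)
open import Relation.Nullary using (¬_; Dec; yes; no; ¬?; contradiction; decidable-stable)
open import Relation.Nullary.Decidable using (map′; _×-dec_; _→-dec_)
open import Relation.Unary using (Decidable)
import Data.Integer as ℤ
import Data.Integer.Properties as ℤ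
import Data.Nat as ℕ
import Data.Nat.Properties as ℕ
import Data.Rational.Properties as ℚ
import Data.Rational.Unnormalised as ℚᵘ
import Data.Rational.Unnormalised.Properties as ℚᵘ
open import Algebra.Properties.Semiring.Sum ℕ.+-*-semiring using (sum-syntax; sum-cong-≗; ∑-comm; ∑-distrib-+; *-distribˡ-sum; *-distribʳ-sum)

-- Decidability of the bihole property

-- Search for a counterexample; if there is none, decidability of `P` removes the double negation.
allSubset? : ∀ {n} {P : Subset n → Set} → Decidable P → Dec (∀ p → P p)
allSubset? P? = map′
  (λ ¬∃¬ p → decidable-stable (P? p) (λ ¬Pp → ¬∃¬ (p , ¬Pp)))
  (λ ∀P (p , ¬Pp) → ¬Pp (∀P p))
  (¬? (anySubset? (¬? ∘ P?)))

allSubsets? : ∀ {n} m {P : Vec (Subset n) m → Set} → Decidable P → Dec (∀ ps → P ps)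
allSubsets? zero    P? = map′ (λ { P[] [] → P[] }) (λ ∀P → ∀P []) (P? [])
allSubsets? (suc m) P? = map′
  (λ { ∀P (p ∷ ps) → ∀P p ps })
  (λ ∀P p ps → ∀P (p ∷ ps))
  (allSubset? λ p → allSubsets? m (P? ∘ (p ∷_)))

hasBihole? : ∀ {n} (G : BipGraph n) k → Dec (HasBihole G k)
hasBihole? G k = anySubset? λ S → anySubset? λ T →
  (∣ S ∣ ℕ.≟ k) ×-dec (∣ T ∣ ℕ.≟ k) ×-dec
  all? λ a → all? λ b → (a ∈? S) →-dec ((b ∈? T) →-dec ¬? (b ∈? G a))

maxDegA≤? : ∀ {n} (G : BipGraph n) Δ → Dec (MaxDegA≤ G Δ)
maxDegA≤? G Δ = all? λ a → ∣ G a ∣ ℕ.≤? Δ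

maxDegA≤-resp-≗ : ∀ {n Δ} {G H : BipGraph n} → G ≗ H → MaxDegA≤ G Δ → MaxDegA≤ H Δ
maxDegA≤-resp-≗ {Δ = Δ} G≗H deg a = subst (λ p → ∣ p ∣ ℕ.≤ Δ) (G≗H a) (deg a)

hasBihole-resp-≗ : ∀ {n k} {G H : BipGraph n} → G ≗ H → HasBihole G k → HasBihole H k
hasBihole-resp-≗ G≗H (S , T , ∣S∣ , ∣T∣ , indep) =
  S , T , ∣S∣ , ∣T∣ , λ a b a∈S b∈T → indep a b a∈S b∈T ∘ subst (b ∈_) (sym (G≗H a))

-- A graph is a function, equal to its tabulation only pointwise. The exhaustive search therefore
-- runs over vectors of neighbourhoods, and the result is carried to arbitrary graphs along `≗`.
allHaveBihole? : ∀ n Δ k → Dec (AllHaveBihole n Δ k)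
allHaveBihole? n Δ k = map′
  (λ all G deg → hasBihole-resp-≗ (lookup∘tabulate G)
    (all (tabulate G) (maxDegA≤-resp-≗ (sym ∘ lookup∘tabulate G) deg)))
  (λ all Ns → all (lookup Ns))
  (allSubsets? n λ Ns → maxDegA≤? (lookup Ns) Δ →-dec hasBihole? (lookup Ns) k)

-- Search downwards from `N`: a failure at `N` lowers the upper bound by one, and the known witness
-- stops the search by 0 at the latest.
greatest : ∀ {P : ℕ → Set} → Decidable P → ∀ N → (∀ k → P k → k ℕ.≤ N) → ∃ P →
           ∃ λ k → P k × (∀ k′ → P k′ → k′ ℕ.≤ k)
greatest {P} P? N bound (k , Pk) with P? N
... | yes PN = N , PN , bound
greatest {P} P? zero bound (k , Pk) | no ¬PN =
  contradiction (subst P (ℕ.n≤0⇒n≡0 (bound k Pk)) Pk) ¬PN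
greatest {P} P? (suc N) bound (k , Pk) | no ¬PN = greatest P? N bound′ (k , Pk)
  where
  bound′ : ∀ k → P k → k ℕ.≤ N
  bound′ k Pk = ℕ.≤-pred (ℕ.≤∧≢⇒< (bound k Pk) λ { refl → ¬PN Pk })

-- Tested on the edgeless graph, which meets every degree bound, even `Δ` = 0.
allHaveBihole⇒≤ : ∀ n Δ k → AllHaveBihole n Δ k → k ℕ.≤ n
allHaveBihole⇒≤ n Δ k all with all (λ _ → ⊥) (λ _ → subst (ℕ._≤ Δ) (sym (∣⊥∣≡0 n)) z≤n)
... | S , _ , ∣S∣≡k , _ = subst (ℕ._≤ n) ∣S∣≡k (∣p∣≤n S)

-- The value of f is characterised as a maximum, so its existence is obtained constructively from
-- decidability and the bound `n`.
isF-exists : ∀ n Δ k → AllHaveBihole n Δ k → ∃ λ f → IsF n Δ f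
isF-exists n Δ k all = greatest (allHaveBihole? n Δ) n (allHaveBihole⇒≤ n Δ) (k , all)

-- Cardinalities of subsets

indicator : Bool → ℕ
indicator true  = 1
indicator false = 0

indicator-∧ : ∀ x y → indicator (x ∧ y) ≡ indicator x ℕ.* indicator y
indicator-∧ true  true  = refl
indicator-∧ true  false = refl
indicator-∧ false y     = refl

∣p∣≡∑ : ∀ {n} (p : Subset n) → ∣ p ∣ ≡ ∑[ x < n ] indicator (lookup p x)
∣p∣≡∑ []            = refl
∣p∣≡∑ (inside  ∷ p) = cong suc (∣p∣≡∑ p)
∣p∣≡∑ (outside ∷ p) = ∣p∣≡∑ p

∑-mono-≤ : ∀ {n} {f g : Fin n → ℕ} → (∀ i → f i ℕ.≤ g i) → ∑[ i < n ] f i ℕ.≤ ∑[ i < n ] g i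
∑-mono-≤ {zero}  f≤g = z≤n
∑-mono-≤ {suc n} f≤g = ℕ.+-mono-≤ (f≤g zero) (∑-mono-≤ (f≤g ∘ suc))

∑-const : ∀ n c → ∑[ i < n ] c ≡ n ℕ.* c
∑-const zero    c = refl
∑-const (suc n) c = cong (c ℕ.+_) (∑-const n c)

∣p─q∣+∣p∩q∣≡∣p∣ : ∀ {n} (p q : Subset n) → ∣ p ─ q ∣ ℕ.+ ∣ p ∩ q ∣ ≡ ∣ p ∣
∣p─q∣+∣p∩q∣≡∣p∣ []            []            = refl
∣p─q∣+∣p∩q∣≡∣p∣ (inside  ∷ p) (inside  ∷ q) = trans (ℕ.+-suc _ _) (cong suc (∣p─q∣+∣p∩q∣≡∣p∣ p q))
∣p─q∣+∣p∩q∣≡∣p∣ (inside  ∷ p) (outside ∷ q) = cong suc (∣p─q∣+∣p∩q∣≡∣p∣ p q)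
∣p─q∣+∣p∩q∣≡∣p∣ (outside ∷ p) (inside  ∷ q) = ∣p─q∣+∣p∩q∣≡∣p∣ p q
∣p─q∣+∣p∩q∣≡∣p∣ (outside ∷ p) (outside ∷ q) = ∣p─q∣+∣p∩q∣≡∣p∣ p q

x∈p─q⇒x∈p×x∉q : ∀ {n} {x : Fin n} p q → x ∈ p ─ q → x ∈ p × x ∉ q
x∈p─q⇒x∈p×x∉q {x = zero}  (inside  ∷ p) (outside ∷ q) here = here , λ ()
x∈p─q⇒x∈p×x∉q {x = zero}  (outside ∷ p) (inside  ∷ q) ()
x∈p─q⇒x∈p×x∉q {x = zero}  (outside ∷ p) (outside ∷ q) ()
x∈p─q⇒x∈p×x∉q {x = suc x} (_ ∷ p) (_ ∷ q) (there x∈) with x∈p─q⇒x∈p×x∉q p q x∈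
... | x∈p , x∉q = there x∈p , λ { (there x∈q) → x∉q x∈q }

∣p∪⁅x⁆∣≡1+∣p∣ : ∀ {n} {x : Fin n} (p : Subset n) → x ∉ p → ∣ p ∪ ⁅ x ⁆ ∣ ≡ suc ∣ p ∣
∣p∪⁅x⁆∣≡1+∣p∣ {x = zero}  (inside  ∷ p) x∉p = contradiction here x∉p
∣p∪⁅x⁆∣≡1+∣p∣ {x = zero}  (outside ∷ p) x∉p = cong (suc ∘ ∣_∣) (∪-identityʳ p)
∣p∪⁅x⁆∣≡1+∣p∣ {x = suc x} (inside  ∷ p) x∉p = cong suc (∣p∪⁅x⁆∣≡1+∣p∣ p (x∉p ∘ there))
∣p∪⁅x⁆∣≡1+∣p∣ {x = suc x} (outside ∷ p) x∉p = ∣p∪⁅x⁆∣≡1+∣p∣ p (x∉p ∘ there)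

subsetOfSize : ∀ {n k} (p : Subset n) → k ℕ.≤ ∣ p ∣ → ∃ λ q → q ⊆ p × ∣ q ∣ ≡ k
subsetOfSize {k = zero}  []            _       = [] , ⊆-refl , refl
subsetOfSize {k = k}     (outside ∷ p) k≤      with subsetOfSize p k≤
... | q , q⊆p , ∣q∣ = outside ∷ q , s⊆s q⊆p , ∣q∣
subsetOfSize {k = zero}  (inside  ∷ p) _       with subsetOfSize p z≤n
... | q , q⊆p , ∣q∣ = outside ∷ q , out⊆ q⊆p , ∣q∣
subsetOfSize {k = suc k} (inside  ∷ p) (s≤s k≤) with subsetOfSize p k≤
... | q , q⊆p , ∣q∣ = inside ∷ q , s⊆s q⊆p , cong suc ∣q∣

-- The greedy step

-- Biholes with unequal sides, the states of the greedy process; `Hole G k k` unfolds to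
-- `HasBihole G k`.
Hole : ∀ {n} → BipGraph n → ℕ → ℕ → Set
Hole {n} G s t = Σ (Subset n) λ S → Σ (Subset n) λ T →
  ∣ S ∣ ≡ s × ∣ T ∣ ≡ t × ((a b : Fin n) → a ∈ S → b ∈ T → ¬ Adj G a b)

module _ {n} (G : BipGraph n) where

  neighbours : Fin n → Subset n
  neighbours b = tabulate λ a → lookup (G a) b

  ∈-neighbours : ∀ {a b} → Adj G a b → a ∈ neighbours b
  ∈-neighbours {a} {b} ab =
    lookup⇒[]= a _ (trans (lookup∘tabulate (λ a → lookup (G a) b) a) ([]=⇒lookup ab))

  trivialHole : Hole G n 0
  trivialHole = ⊤ , ⊥ , ∣⊤∣≡n n , ∣⊥∣≡0 n , λ _ _ _ b∈⊥ → contradiction b∈⊥ ∉⊥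

  -- Independence passes to subsets of `S`. This lets a greedy step be charged exactly `d` vertices
  -- even when it loses fewer.
  shrink : ∀ {s s′ t} → s′ ℕ.≤ s → Hole G s t → Hole G s′ t
  shrink s′≤s (S , T , refl , ∣T∣ , indep) with subsetOfSize S s′≤s
  ... | S′ , S′⊆S , ∣S′∣ = S′ , T , ∣S′∣ , ∣T∣ , λ a b a∈S′ → indep a b (S′⊆S a∈S′)

  ∣S∩N∣≡∑ : ∀ S b → ∣ S ∩ neighbours b ∣ ≡
            ∑[ a < n ] (indicator (lookup S a) ℕ.* indicator (lookup (G a) b))
  ∣S∩N∣≡∑ S b = trans (∣p∣≡∑ (S ∩ neighbours b)) (sum-cong-≗ λ a →
    trans (cong indicator (trans (lookup-zipWith _∧_ a S (neighbours b))
                                 (cong (lookup S a ∧_) (lookup∘tabulate _ a))))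
          (indicator-∧ (lookup S a) _))

  module _ {Δ} (deg : MaxDegA≤ G Δ) where

    -- Double counting of the edges between `S` and B, first from the side of B, then from `S`.
    ∑-degree-≤ : ∀ S → ∑[ b < n ] ∣ S ∩ neighbours b ∣ ℕ.≤ Δ ℕ.* ∣ S ∣
    ∑-degree-≤ S = begin
      ∑[ b < n ] ∣ S ∩ neighbours b ∣
        ≡⟨ sum-cong-≗ (∣S∩N∣≡∑ S) ⟩
      ∑[ b < n ] ∑[ a < n ] (𝟙S a ℕ.* 𝟙G a b)
        ≡⟨ ∑-comm (λ b a → 𝟙S a ℕ.* 𝟙G a b) ⟩
      ∑[ a < n ] ∑[ b < n ] (𝟙S a ℕ.* 𝟙G a b)
        ≡⟨ sum-cong-≗ (λ a → *-distribˡ-sum (𝟙S a) (𝟙G a)) ⟨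
      ∑[ a < n ] (𝟙S a ℕ.* ∑[ b < n ] 𝟙G a b)
        ≡⟨ sum-cong-≗ (λ a → cong (𝟙S a ℕ.*_) (∣p∣≡∑ (G a))) ⟨
      ∑[ a < n ] (𝟙S a ℕ.* ∣ G a ∣)
        ≤⟨ ∑-mono-≤ (λ a → ℕ.*-monoʳ-≤ (𝟙S a) (deg a)) ⟩
      ∑[ a < n ] (𝟙S a ℕ.* Δ)
        ≡⟨ *-distribʳ-sum Δ 𝟙S ⟨
      (∑[ a < n ] 𝟙S a) ℕ.* Δ
        ≡⟨ cong (ℕ._* Δ) (∣p∣≡∑ S) ⟨
      ∣ S ∣ ℕ.* Δ
        ≡⟨ ℕ.*-comm ∣ S ∣ Δ ⟩
      Δ ℕ.* ∣ S ∣ ∎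
      where
      open ℕ.≤-Reasoning
      𝟙S : Fin n → ℕ
      𝟙S a = indicator (lookup S a)
      𝟙G : Fin n → Fin n → ℕ
      𝟙G a b = indicator (lookup (G a) b)

    -- Averaging: otherwise each of the `n` - |T| vertices outside `T` sends at least `d` + 1 edges
    -- to `S`, more than `Δ`|S| in total. The term for `T` stands on the left to avoid subtraction.
    lowDegreeVertex : ∀ S T d → Δ ℕ.* ∣ S ∣ ℕ.+ suc d ℕ.* ∣ T ∣ ℕ.< suc d ℕ.* n →
                      ∃ λ b → b ∉ T × ∣ S ∩ neighbours b ∣ ℕ.≤ d
    lowDegreeVertex S T d few
      with any? (λ b → ¬? (b ∈? T) ×-dec (∣ S ∩ neighbours b ∣ ℕ.≤? d))
    ... | yes found = found
    ... | no  none  = contradiction few (ℕ.≤⇒≯ (begin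
      suc d ℕ.* n
        ≡⟨ ℕ.*-comm (suc d) n ⟩
      n ℕ.* suc d
        ≡⟨ ∑-const n (suc d) ⟨
      ∑[ b < n ] (suc d)
        ≤⟨ ∑-mono-≤ high ⟩
      ∑[ b < n ] (∣ S ∩ neighbours b ∣ ℕ.+ suc d ℕ.* 𝟙T b)
        ≡⟨ ∑-distrib-+ (λ b → ∣ S ∩ neighbours b ∣) (λ b → suc d ℕ.* 𝟙T b) ⟩
      ∑[ b < n ] ∣ S ∩ neighbours b ∣ ℕ.+ ∑[ b < n ] (suc d ℕ.* 𝟙T b)
        ≡⟨ cong (∑[ b < n ] ∣ S ∩ neighbours b ∣ ℕ.+_) (*-distribˡ-sum (suc d) 𝟙T) ⟨
      ∑[ b < n ] ∣ S ∩ neighbours b ∣ ℕ.+ suc d ℕ.* ∑[ b < n ] 𝟙T b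
        ≡⟨ cong (λ t → ∑[ b < n ] ∣ S ∩ neighbours b ∣ ℕ.+ suc d ℕ.* t) (∣p∣≡∑ T) ⟨
      ∑[ b < n ] ∣ S ∩ neighbours b ∣ ℕ.+ suc d ℕ.* ∣ T ∣
        ≤⟨ ℕ.+-monoˡ-≤ (suc d ℕ.* ∣ T ∣) (∑-degree-≤ S) ⟩
      Δ ℕ.* ∣ S ∣ ℕ.+ suc d ℕ.* ∣ T ∣ ∎))
      where
      open ℕ.≤-Reasoning
      𝟙T : Fin n → ℕ
      𝟙T b = indicator (lookup T b)
      -- A vertex of `T` reaches `suc d` through the indicator term alone, any other through its
      -- degree into `S`.
      high : ∀ b → suc d ℕ.≤ ∣ S ∩ neighbours b ∣ ℕ.+ suc d ℕ.* 𝟙T b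
      high b with b ∈? T
      ... | yes b∈T rewrite []=⇒lookup b∈T =
        ℕ.≤-trans (ℕ.≤-reflexive (sym (ℕ.*-identityʳ (suc d)))) (ℕ.m≤n+m _ _)
      ... | no  b∉T =
        ℕ.≤-trans (ℕ.≰⇒> (λ low → none (b , b∉T , low))) (ℕ.m≤m+n _ _)

    greedyStep : ∀ {d s t} → Δ ℕ.* (d ℕ.+ s) ℕ.+ suc d ℕ.* t ℕ.< suc d ℕ.* n →
                 Hole G (d ℕ.+ s) t → Hole G s (suc t)
    greedyStep {d} {s} few (S , T , ∣S∣ , refl , indep)
      with lowDegreeVertex S T d
             (subst (λ x → Δ ℕ.* x ℕ.+ suc d ℕ.* ∣ T ∣ ℕ.< suc d ℕ.* n) (sym ∣S∣) few)
    ... | b , b∉T , low = shrink s≤∣S′∣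
      (S ─ neighbours b , T ∪ ⁅ b ⁆ , refl , ∣p∪⁅x⁆∣≡1+∣p∣ T b∉T , indep′)
      where
      open ℕ.≤-Reasoning
      s≤∣S′∣ : s ℕ.≤ ∣ S ─ neighbours b ∣
      s≤∣S′∣ = ℕ.+-cancelˡ-≤ d _ _ (begin
        d ℕ.+ s                                         ≡⟨ ∣S∣ ⟨
        ∣ S ∣                                           ≡⟨ ∣p─q∣+∣p∩q∣≡∣p∣ S (neighbours b) ⟨
        ∣ S ─ neighbours b ∣ ℕ.+ ∣ S ∩ neighbours b ∣   ≤⟨ ℕ.+-monoʳ-≤ _ low ⟩
        ∣ S ─ neighbours b ∣ ℕ.+ d                      ≡⟨ ℕ.+-comm _ d ⟩
        d ℕ.+ ∣ S ─ neighbours b ∣                      ∎)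
      -- Old vertices of `T` were already non-adjacent to `S`; the neighbours of the new vertex `b`
      -- have just been removed.
      indep′ : ∀ a c → a ∈ S ─ neighbours b → c ∈ T ∪ ⁅ b ⁆ → ¬ Adj G a c
      indep′ a c a∈S′ c∈T′ ac with x∈p─q⇒x∈p×x∉q S (neighbours b) a∈S′ | x∈p∪q⁻ T ⁅ b ⁆ c∈T′
      ... | a∈S , _   | inj₁ c∈T = indep a c a∈S c∈T ac
      ... | _   , a∉N | inj₂ c∈b with x∈⁅y⁆⇒x≡y b c∈b
      ...   | refl = a∉N (∈-neighbours ac)

    -- A step lowers Δ|S| by Δd and raises (d+1)|T| by d+1 ≤ Δd, so the averaging
    -- condition need only be imposed at the start.
    greedy : ∀ {d s t} j → suc d ℕ.≤ Δ ℕ.* d →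
             Δ ℕ.* (j ℕ.* d ℕ.+ s) ℕ.+ suc d ℕ.* t ℕ.< suc d ℕ.* n →
             Hole G (j ℕ.* d ℕ.+ s) t → Hole G s (j ℕ.+ t)
    greedy zero _ _ hole = hole
    greedy {d} {s} {t} (suc j) d<Δd few hole =
      subst (Hole G s) (ℕ.+-suc j t)
        (greedy j d<Δd (ℕ.≤-<-trans few′ few₁)
          (greedyStep {d} few₁ (subst (λ x → Hole G x t) assoc hole)))
      where
      open ℕ.≤-Reasoning
      assoc : suc j ℕ.* d ℕ.+ s ≡ d ℕ.+ (j ℕ.* d ℕ.+ s)
      assoc = ℕ.+-assoc d (j ℕ.* d) s
      few₁ : Δ ℕ.* (d ℕ.+ (j ℕ.* d ℕ.+ s)) ℕ.+ suc d ℕ.* t ℕ.< suc d ℕ.* n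
      few₁ = subst (λ x → Δ ℕ.* x ℕ.+ suc d ℕ.* t ℕ.< suc d ℕ.* n) assoc few
      rearrange : ∀ Δ d x t → Δ ℕ.* x ℕ.+ (Δ ℕ.* d ℕ.+ suc d ℕ.* t) ≡ Δ ℕ.* (d ℕ.+ x) ℕ.+ suc d ℕ.* t
      rearrange = solve-∀
      few′ : Δ ℕ.* (j ℕ.* d ℕ.+ s) ℕ.+ suc d ℕ.* suc t ℕ.≤
             Δ ℕ.* (d ℕ.+ (j ℕ.* d ℕ.+ s)) ℕ.+ suc d ℕ.* t
      few′ = begin
        Δ ℕ.* (j ℕ.* d ℕ.+ s) ℕ.+ suc d ℕ.* suc t
          ≡⟨ cong (Δ ℕ.* (j ℕ.* d ℕ.+ s) ℕ.+_) (ℕ.*-suc (suc d) t) ⟩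
        Δ ℕ.* (j ℕ.* d ℕ.+ s) ℕ.+ (suc d ℕ.+ suc d ℕ.* t)
          ≤⟨ ℕ.+-monoʳ-≤ (Δ ℕ.* (j ℕ.* d ℕ.+ s)) (ℕ.+-monoˡ-≤ (suc d ℕ.* t) d<Δd) ⟩
        Δ ℕ.* (j ℕ.* d ℕ.+ s) ℕ.+ (Δ ℕ.* d ℕ.+ suc d ℕ.* t)
          ≡⟨ rearrange Δ d (j ℕ.* d ℕ.+ s) t ⟩
        Δ ℕ.* (d ℕ.+ (j ℕ.* d ℕ.+ s)) ℕ.+ suc d ℕ.* t ∎

-- The 3/8 bound for maximum degree 3

-- With p = m + 2, the three phases take (|S|, |T|) from (8p, 0) to (8p − 3, 1),
-- then to (4p − 3, 2p + 1), then to (3p − 1, 3p − 1).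
allHaveBihole-3/8 : ∀ {n} m → 8 ℕ.* m ℕ.+ 16 ℕ.≤ n → AllHaveBihole n 3 (3 ℕ.* m ℕ.+ 5)
allHaveBihole-3/8 {n} m 8p≤n G deg = subst (Hole G (3 ℕ.* m ℕ.+ 5)) (t₃ m) phase₃
  where
  open ℕ.≤-Reasoning

  -- The explicit slack `suc g` turns each averaging condition into a ring identity at 8p, which
  -- `8p≤n` then transfers to `n`.
  few : ∀ c {x} g → x ℕ.+ suc g ≡ c ℕ.* (8 ℕ.* m ℕ.+ 16) → x ℕ.< c ℕ.* n
  few c {x} g eq = begin
    suc x                       ≤⟨ s≤s (ℕ.m≤m+n x g) ⟩
    suc (x ℕ.+ g)               ≡⟨ ℕ.+-suc x g ⟨
    x ℕ.+ suc g                 ≡⟨ eq ⟩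
    c ℕ.* (8 ℕ.* m ℕ.+ 16)      ≤⟨ ℕ.*-monoʳ-≤ c 8p≤n ⟩
    c ℕ.* n                     ∎

  -- At the start 3|S| = 3 · 8p, so the strict condition fails for `d` = 2. A single step with `d` =
  -- 3 brings 3|S| + 3|T| down to 24p - 6.
  phase₁ : Hole G (8 ℕ.* m ℕ.+ 13) 1
  phase₁ = greedy G deg {d = 3} 1 (ℕ.m≤m+n 4 5) (few 4 (8 ℕ.* m ℕ.+ 15) (gap m))
    (subst (λ s → Hole G s 0) (size m) (shrink G 8p≤n (trivialHole G)))
    where
    size : ∀ m → 8 ℕ.* m ℕ.+ 16 ≡ 1 ℕ.* 3 ℕ.+ (8 ℕ.* m ℕ.+ 13)
    size = solve-∀
    gap : ∀ m → 3 ℕ.* (1 ℕ.* 3 ℕ.+ (8 ℕ.* m ℕ.+ 13)) ℕ.+ 4 ℕ.* 0 ℕ.+ suc (8 ℕ.* m ℕ.+ 15)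
              ≡ 4 ℕ.* (8 ℕ.* m ℕ.+ 16)
    gap = solve-∀

  -- After 2p steps 3|S| + 2|T| = 16p - 7, below the 2 · 8p required for `d` = 1.
  phase₂ : Hole G (4 ℕ.* m ℕ.+ 5) (2 ℕ.* m ℕ.+ 4 ℕ.+ 1)
  phase₂ = greedy G deg {d = 2} (2 ℕ.* m ℕ.+ 4) (ℕ.m≤m+n 3 3) (few 3 5 (gap m))
    (subst (λ s → Hole G s 1) (size m) phase₁)
    where
    size : ∀ m → 8 ℕ.* m ℕ.+ 13 ≡ (2 ℕ.* m ℕ.+ 4) ℕ.* 2 ℕ.+ (4 ℕ.* m ℕ.+ 5)
    size = solve-∀
    gap : ∀ m → 3 ℕ.* ((2 ℕ.* m ℕ.+ 4) ℕ.* 2 ℕ.+ (4 ℕ.* m ℕ.+ 5)) ℕ.+ 3 ℕ.* 1 ℕ.+ 6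
              ≡ 3 ℕ.* (8 ℕ.* m ℕ.+ 16)
    gap = solve-∀

  -- The sides now differ by 2`m`, and each step with `d` = 1 narrows the difference by 2, so `m`
  -- steps make them equal.
  phase₃ : Hole G (3 ℕ.* m ℕ.+ 5) (m ℕ.+ (2 ℕ.* m ℕ.+ 4 ℕ.+ 1))
  phase₃ = greedy G deg {d = 1} m (ℕ.m≤m+n 2 1) (few 2 6 (gap m))
    (subst (λ s → Hole G s (2 ℕ.* m ℕ.+ 4 ℕ.+ 1)) (size m) phase₂)
    where
    size : ∀ m → 4 ℕ.* m ℕ.+ 5 ≡ m ℕ.* 1 ℕ.+ (3 ℕ.* m ℕ.+ 5)
    size = solve-∀
    gap : ∀ m → 3 ℕ.* (m ℕ.* 1 ℕ.+ (3 ℕ.* m ℕ.+ 5)) ℕ.+ 2 ℕ.* (2 ℕ.* m ℕ.+ 4 ℕ.+ 1) ℕ.+ 7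
              ≡ 2 ℕ.* (8 ℕ.* m ℕ.+ 16)
    gap = solve-∀

  t₃ : ∀ m → m ℕ.+ (2 ℕ.* m ℕ.+ 4 ℕ.+ 1) ≡ 3 ℕ.* m ℕ.+ 5
  t₃ = solve-∀

-- With q = ⌊(n − 136) / 8⌋, the bihole has order k = 50 + 3q, while n ≤ 143 + 8q.
largeBiholes : ∀ α β → α ℕ.* 143 ℕ.≤ β ℕ.* 50 → α ℕ.* 8 ℕ.≤ β ℕ.* 3 → ∀ n → 136 ℕ.≤ n →
               ∃ λ k → AllHaveBihole n 3 k × α ℕ.* n ℕ.≤ β ℕ.* k
largeBiholes α β base slope n 136≤n =
  -- Here 136 = 8 · 15 + 16 and 50 = 3 · 15 + 5. The offset 15 is the least for which the analogue
  -- of `base` holds with `α` = 34917 and `β` = 100000.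
  3 ℕ.* (15 ℕ.+ q) ℕ.+ 5 , allHaveBihole-3/8 (15 ℕ.+ q) fits , large
  where
  open ℕ.≤-Reasoning
  x = n ℕ.∸ 136
  q = x ℕ./ 8
  r = x % 8
  n≡ : n ≡ 136 ℕ.+ (r ℕ.+ q ℕ.* 8)
  n≡ = trans (sym (ℕ.m+[n∸m]≡n 136≤n)) (cong (136 ℕ.+_) (m≡m%n+[m/n]*n x 8))
  regroup : ∀ q r → 8 ℕ.* (15 ℕ.+ q) ℕ.+ 16 ℕ.+ r ≡ 136 ℕ.+ (r ℕ.+ q ℕ.* 8)
  regroup = solve-∀
  fits : 8 ℕ.* (15 ℕ.+ q) ℕ.+ 16 ℕ.≤ n
  fits = begin
    8 ℕ.* (15 ℕ.+ q) ℕ.+ 16          ≤⟨ ℕ.m≤m+n _ r ⟩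
    8 ℕ.* (15 ℕ.+ q) ℕ.+ 16 ℕ.+ r    ≡⟨ regroup q r ⟩
    136 ℕ.+ (r ℕ.+ q ℕ.* 8)          ≡⟨ n≡ ⟨
    n                                ∎
  expandˡ : ∀ α q → α ℕ.* (136 ℕ.+ (7 ℕ.+ q ℕ.* 8)) ≡ α ℕ.* 143 ℕ.+ α ℕ.* 8 ℕ.* q
  expandˡ = solve-∀
  expandʳ : ∀ β q → β ℕ.* 50 ℕ.+ β ℕ.* 3 ℕ.* q ≡ β ℕ.* (3 ℕ.* (15 ℕ.+ q) ℕ.+ 5)
  expandʳ = solve-∀
  large : α ℕ.* n ℕ.≤ β ℕ.* (3 ℕ.* (15 ℕ.+ q) ℕ.+ 5)
  large = begin
    α ℕ.* n
      ≡⟨ cong (α ℕ.*_) n≡ ⟩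
    α ℕ.* (136 ℕ.+ (r ℕ.+ q ℕ.* 8))
      ≤⟨ ℕ.*-monoʳ-≤ α (ℕ.+-monoʳ-≤ 136 (ℕ.+-monoˡ-≤ (q ℕ.* 8) (ℕ.≤-pred (m%n<n x 8)))) ⟩
    α ℕ.* (136 ℕ.+ (7 ℕ.+ q ℕ.* 8))
      ≡⟨ expandˡ α q ⟩
    α ℕ.* 143 ℕ.+ α ℕ.* 8 ℕ.* q
      ≤⟨ ℕ.+-mono-≤ base (ℕ.*-monoˡ-≤ q slope) ⟩
    β ℕ.* 50 ℕ.+ β ℕ.* 3 ℕ.* q
      ≡⟨ expandʳ β q ⟩
    β ℕ.* (3 ℕ.* (15 ℕ.+ q) ℕ.+ 5) ∎

-- Transfer to rational inequalities

-- Unnormalised rationals keep numerator and denominator as given, so there the comparison is plain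
-- cross-multiplication.
/-*-≤ : ∀ p q n k → p ℕ.* n ℕ.≤ suc q ℕ.* k → (+ p / suc q) * (+ n / 1) ≤ + k / 1
/-*-≤ p q n k pn≤qk = ℚ.toℚᵘ-cancel-≤ (begin
  toℚᵘ ((+ p / suc q) * (+ n / 1))
    ≃⟨ ℚ.toℚᵘ-homo-* (+ p / suc q) (+ n / 1) ⟩
  toℚᵘ (+ p / suc q) ℚᵘ.* toℚᵘ (+ n / 1)
    ≃⟨ ℚᵘ.*-cong (ℚ.toℚᵘ-fromℚᵘ (ℚᵘ.mkℚᵘ (+ p) q)) (ℚ.toℚᵘ-fromℚᵘ (ℚᵘ.mkℚᵘ (+ n) 0)) ⟩
  ℚᵘ.mkℚᵘ (+ p) q ℚᵘ.* ℚᵘ.mkℚᵘ (+ n) 0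
    ≤⟨ ℚᵘ.*≤* cross ⟩
  ℚᵘ.mkℚᵘ (+ k) 0
    ≃⟨ ℚ.toℚᵘ-fromℚᵘ (ℚᵘ.mkℚᵘ (+ k) 0) ⟨
  toℚᵘ (+ k / 1) ∎)
  where
  open ℚᵘ.≤-Reasoning
  cross : + p ℤ.* + n ℤ.* + 1 ℤ.≤ + k ℤ.* + (suc q ℕ.* 1)
  cross = subst₂ ℤ._≤_
    (sym (trans (ℤ.*-identityʳ (+ p ℤ.* + n)) (sym (ℤ.pos-* p n))))
    (trans (cong +_ (trans (ℕ.*-comm (suc q) k) (cong (k ℕ.*_) (sym (ℕ.*-identityʳ (suc q))))))
           (ℤ.pos-* k (suc q ℕ.* 1)))
    (ℤ.+≤+ pn≤qk)

p-q≤p : ∀ p {q} → 0ℚ ≤ q → p - q ≤ p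
p-q≤p p 0≤q = ℚ.≤-trans (ℚ.+-monoʳ-≤ p (ℚ.neg-antimono-≤ 0≤q)) (ℚ.≤-reflexive (ℚ.+-identityʳ p))

[p/q-ε]*n≤k : ∀ p q n k ε → 0ℚ ≤ ε → p ℕ.* n ℕ.≤ suc q ℕ.* k →
              (+ p / suc q - ε) * (+ n / 1) ≤ + k / 1
[p/q-ε]*n≤k p q n k ε 0≤ε pn≤qk = ℚ.≤-trans
  (ℚ.*-monoʳ-≤-nonNeg (+ n / 1) {{ℚ.normalize-nonNeg n 1}} (p-q≤p (+ p / suc q) 0≤ε))
  (/-*-≤ p q n k pn≤qk)

theorem4 : (ε : ℚ) → 0ℚ ≤ ε →
    Σ ℕ λ n₀ → (n : ℕ) → n₀ Data.Nat.≤ n →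
    Σ ℕ λ k → IsF n 3 k × ((+ 34917 / 100000 - ε) * (+ n / 1) ≤ (+ k / 1))
-- One threshold serves every `ε`: the bound is first proved with `ε` = 0, and subtracting `ε` only
-- weakens it.
theorem4 ε 0≤ε = 136 , λ n 136≤n →
  -- Evaluation settles 34917 · 143 = 4993131 ≤ 5000000 and 34917 · 8 = 279336 ≤ 300000.
  let k₀ , all , large = largeBiholes 34917 100000 (ℕ.≤ᵇ⇒≤ _ _ _) (ℕ.≤ᵇ⇒≤ _ _ _) n 136≤n
      k , isF          = isF-exists n 3 k₀ all
  in k , isF , [p/q-ε]*n≤k 34917 99999 n k ε 0≤ε
       -- Maximality of `k` gives `k₀` ≤ `k`.
       (ℕ.≤-trans large (ℕ.*-monoʳ-≤ 100000 (proj₂ isF k₀ all)))
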